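{- For all integers $n\ge 1$ and $m$ with $1\le m\le n$, $$\sum_{k=0}^{n-m}\frac{n\binom{k+m-1}{k}}{n+k}\,B_k^{(n+k)}\,S_2(n,k+m)=\delta_{m,n},$$ where $\delta_{m,n}$ is the Kronecker symbol.
   Context: For an integer $r\ge 0$, the Bernoulli numbers of order $r$, $B_k^{(r)}$, are defined by $\left(\frac{t}{e^t-1}\right)^r=\sum_{k=0}^{\infty}B_k^{(r)}\frac{t^k}{k!}$. $S_2(n,k)$ denotes the Stirling numbers of the second kind. -}

module Defs where

open import Algebra.Bundles using (CommutativeRing)
open import Data.Bool.Base using (if_then_else_)
open import Data.Fin.Base using (zero; suc; toℕ)
open import Data.Integer.Base using (+_)
open import Data.Nat.Base as ℕ using (ℕ; zero; suc; _∸_; _≡ᵇ_; _!)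
open import Data.Nat.Properties using (_!≢0)
open import Data.Rational.Base using (ℚ; 0ℚ; 1ℚ; _+_; _*_; _-_; -_; _/_; 1/_; NonZero)
open import Data.Rational.Properties
open import Data.Vec.Base using (Vec; []; _∷_; head; lookup)
open import Relation.Binary.PropositionalEquality
  using (_≡_; _≗_; refl; sym; trans; cong; cong₂; module ≡-Reasoning)

open import Algebra.Properties.Semiring.Sum
  (CommutativeRing.semiring +-*-commutativeRing) public
  using (sum; sum-syntax; sum⁺-syntax; sum-cong-≗)

m+n≢0 : ∀ m n → .{{ℕ.NonZero m}} → ℕ.NonZero (m ℕ.+ n)
m+n≢0 (suc m) n = _

δ : ℕ → ℕ → ℚ
δ m n = if m ≡ᵇ n then 1ℚ else 0ℚ

S₂ : ℕ → ℕ → ℕ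
S₂ zero    zero    = 1
S₂ zero    (suc k) = 0
S₂ (suc n) zero    = 0
S₂ (suc n) (suc k) = suc k ℕ.* S₂ n (suc k) ℕ.+ S₂ n k

-- f represents the formal power series ∑ₙ f(n) tⁿ.
PowerSeries : Set
PowerSeries = ℕ → ℚ

infixl 6 _⊖_
infixl 7 _⊛_
infixr 8 _^_

𝟙 : PowerSeries
𝟙 n = δ n 0

𝕥 : PowerSeries
𝕥 n = δ n 1

_⊖_ : PowerSeries → PowerSeries → PowerSeries
(f ⊖ g) n = f n - g n

_⊛_ : PowerSeries → PowerSeries → PowerSeries
(f ⊛ g) n = ∑[ i ≤ n ] (f (toℕ i) * g (n ∸ toℕ i))

_^_ : PowerSeries → ℕ → PowerSeries
f ^ zero  = 𝟙
f ^ suc r = f ⊛ f ^ r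

-- Division by t; meaningful as such only when f has zero constant term.
_/𝕥 : PowerSeries → PowerSeries
(f /𝕥) n = f (suc n)

module _ (f : PowerSeries) .{{_ : NonZero (f 0)}} where

  -- The coefficients gₙ, …, g₀ of 1/f, obtained by solving
  -- f₀ gₙ₊₁ + ∑ᵢ fᵢ₊₁ gₙ₋ᵢ = 0.
  inverseCoeffs : ∀ n → Vec ℚ (suc n)
  inverseCoeffs zero    = (1/ f 0) ∷ []
  inverseCoeffs (suc n) =
    - ((1/ f 0) * (∑[ i ≤ n ] (f (suc (toℕ i)) * lookup (inverseCoeffs n) i)))
      ∷ inverseCoeffs n

  inverse : PowerSeries
  inverse n = head (inverseCoeffs n)

  lookup-inverseCoeffs : ∀ n i → lookup (inverseCoeffs n) i ≡ inverse (n ∸ toℕ i)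
  lookup-inverseCoeffs zero    zero    = refl
  lookup-inverseCoeffs (suc n) zero    = refl
  lookup-inverseCoeffs (suc n) (suc i) = lookup-inverseCoeffs n i

  ⊛-inverseʳ : f ⊛ inverse ≗ 𝟙
  ⊛-inverseʳ zero    = trans (+-identityʳ _) (*-inverseʳ (f 0))
  ⊛-inverseʳ (suc n) = begin
    f 0 * - ((1/ f 0) * s) + s′   ≡⟨ cong₂ _+_ (sym (neg-distribʳ-* (f 0) _)) (sym s≡s′) ⟩
    - (f 0 * ((1/ f 0) * s)) + s  ≡⟨ cong (λ x → - x + s) (sym (*-assoc (f 0) _ s)) ⟩
    - (f 0 * (1/ f 0) * s) + s    ≡⟨ cong (λ x → - (x * s) + s) (*-inverseʳ (f 0)) ⟩
    - (1ℚ * s) + s                ≡⟨ cong (λ x → - x + s) (*-identityˡ s) ⟩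
    - s + s                       ≡⟨ +-inverseˡ s ⟩
    0ℚ                            ∎
    where
    open ≡-Reasoning
    s s′ : ℚ
    s  = ∑[ i ≤ n ] (f (suc (toℕ i)) * lookup (inverseCoeffs n) i)
    s′ = ∑[ i ≤ n ] (f (suc (toℕ i)) * inverse (n ∸ toℕ i))
    s≡s′ : s ≡ s′
    s≡s′ = sum-cong-≗ λ i → cong (f (suc (toℕ i)) *_) (lookup-inverseCoeffs n i)

eᵗ : PowerSeries
eᵗ n = (+ 1 / n !) {{n !≢0}}

-- The series t/(eᵗ − 1), as the reciprocal of (eᵗ − 1)/t.
t/[eᵗ-1] : PowerSeries
t/[eᵗ-1] = inverse ((eᵗ ⊖ 𝟙) /𝕥)

[eᵗ-1]⊛t/[eᵗ-1] : (eᵗ ⊖ 𝟙) ⊛ t/[eᵗ-1] ≗ 𝕥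
[eᵗ-1]⊛t/[eᵗ-1] zero    = refl
[eᵗ-1]⊛t/[eᵗ-1] (suc n) = begin
  0ℚ * t/[eᵗ-1] (suc n) + p n  ≡⟨ cong (_+ p n) (*-zeroˡ (t/[eᵗ-1] (suc n))) ⟩
  0ℚ + p n                     ≡⟨ +-identityˡ (p n) ⟩
  p n                          ≡⟨ ⊛-inverseʳ ((eᵗ ⊖ 𝟙) /𝕥) n ⟩
  𝟙 n                          ∎
  where
  open ≡-Reasoning
  p : PowerSeries
  p = (eᵗ ⊖ 𝟙) /𝕥 ⊛ t/[eᵗ-1]

-- B r k is the Bernoulli number of order r usually written B_k^{(r)}.
B : ℕ → ℕ → ℚ
B r k = (+ (k !) / 1) * (t/[eᵗ-1] ^ r) k

{-# OPTIONS --safe #-}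

-- Write φ = eᵗ − 1, τ = t/φ and p = φ/t, and let [tᵏ] extract a coefficient.
-- The Stirling numbers are S₂(n,k) = (n!/k!) [tⁿ] φᵏ, and the Lagrange-type identity
-- (n/(n+k)) [tᵏ] τⁿ⁺ᵏ = [tᵏ] τⁿ eᵗ τᵏ⁺¹ = Res(τⁿ φ′/φᵏ⁺¹) turns the Bernoulli factor
-- into the k-th coefficient of the expansion of τⁿ in powers of φ.  Up to the factor
-- (n−1)!/(m−1)! the sum is therefore [tⁿ⁻ᵐ] of τⁿ pᵐ⁻¹ eᵗ = eᵗ τⁿ⁻ᵐ⁺¹, which is the
-- residue of φ′/φⁿ⁻ᵐ⁺¹, that is, 1 if n = m and 0 otherwise.
module Submission where

open import Defs
open import Algebra.Bundles using (CommutativeRing; CommutativeSemiring)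
import Algebra.Construct.Pointwise as Pointwise
import Algebra.Solver.Ring.NaturalCoefficients.Default as SemiringSolver
open import Algebra.Structures using (IsCommutativeMonoid)
open import Algebra.Structures.Biased using (IsCommutativeSemiringˡ)
open import Data.Fin.Base using (toℕ)
open import Data.Integer.Base as ℤ using (+_)
import Data.Integer.Properties as ℤ
open import Data.Nat.Base using (ℕ; zero; suc; s≤s; NonZero; _+_; _∸_; _≤_; _!) renaming (_*_ to _*ℕ_)
open import Data.Nat.Combinatorics using (_C_; nCk≡n!/k![n-k]!; k![n∸k]!∣n!)
open import Data.Nat.DivMod using (m/n*n≡m) renaming (_/_ to _ℕ/_)
open import Data.Nat.Properties as ℕ using (_!≢0; _!*_!≢0)
open import Data.Product.Base using (_,_)
open import Data.Rational.Base as ℚ using (ℚ; 0ℚ; 1ℚ; _*_; _/_)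
import Data.Rational.Properties as ℚ
open import Data.Rational.Solver using (module +-*-Solver)
open import Data.Rational.Unnormalised.Base as ℚᵘ using (mkℚᵘ; *≡*)
import Data.Rational.Unnormalised.Properties as ℚᵘ
open import Level using (0ℓ)
open import Relation.Binary.PropositionalEquality
  using (_≡_; _≗_; refl; sym; trans; cong; cong₂; subst; module ≡-Reasoning)

open import Algebra.Properties.Group ℚ.+-0-group using () renaming (∙-cancelʳ to +-cancelʳ)
open import Algebra.Properties.Semiring.Sum (CommutativeRing.semiring ℚ.+-*-commutativeRing)
  using (*-distribˡ-sum)
open +-*-Solver using (con; _:+_; _:*_; _:=_) renaming (solve to solveℚ)

-- Natural numbers inside the rationals

fromℕ : ℕ → ℚ
fromℕ n = + n / 1

-- The quotient `_/_` is reduced to lowest terms, which hides numerator and denominator. In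
-- unnormalised rationals they are visible again, and identities become integer arithmetic.
toℚᵘ-/ : ∀ i d → ℚ.toℚᵘ (i / suc d) ℚᵘ.≃ mkℚᵘ i d
toℚᵘ-/ i d = ℚ.toℚᵘ-fromℚᵘ (mkℚᵘ i d)

fromℕ-+ : ∀ m n → fromℕ (m + n) ≡ fromℕ m ℚ.+ fromℕ n
fromℕ-+ m n = ℚ.toℚᵘ-injective (begin
  ℚ.toℚᵘ (fromℕ (m + n))                 ≈⟨ toℚᵘ-/ (+ (m + n)) 0 ⟩
  mkℚᵘ (+ (m + n)) 0                       ≈⟨ *≡* (cong (ℤ._* + 1) (sym (cong₂ ℤ._+_ (ℤ.*-identityʳ (+ m)) (ℤ.*-identityʳ (+ n))))) ⟩
  mkℚᵘ (+ m) 0 ℚᵘ.+ mkℚᵘ (+ n) 0           ≈⟨ ℚᵘ.+-cong (toℚᵘ-/ (+ m) 0) (toℚᵘ-/ (+ n) 0) ⟨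
  ℚ.toℚᵘ (fromℕ m) ℚᵘ.+ ℚ.toℚᵘ (fromℕ n)   ≈⟨ ℚ.toℚᵘ-homo-+ (fromℕ m) (fromℕ n) ⟨
  ℚ.toℚᵘ (fromℕ m ℚ.+ fromℕ n)             ∎)
  where open ℚᵘ.≃-Reasoning 

/-*-fromℕ : ∀ a d .{{_ : NonZero d}} → + a / d * fromℕ d ≡ fromℕ a
/-*-fromℕ a (suc d) = ℚ.toℚᵘ-injective (begin
  ℚ.toℚᵘ (+ a / suc d * fromℕ (suc d))                ≈⟨ ℚ.toℚᵘ-homo-* (+ a / suc d) (fromℕ (suc d)) ⟩
  ℚ.toℚᵘ (+ a / suc d) ℚᵘ.* ℚ.toℚᵘ (fromℕ (suc d))    ≈⟨ ℚᵘ.*-cong (toℚᵘ-/ (+ a) d) (toℚᵘ-/ (+ suc d) 0) ⟩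
  mkℚᵘ (+ a) d ℚᵘ.* mkℚᵘ (+ suc d) 0                  ≈⟨ *≡* (ℤ.*-assoc (+ a) (+ suc d) (+ 1)) ⟩
  mkℚᵘ (+ a) 0                                        ≈⟨ toℚᵘ-/ (+ a) 0 ⟨
  ℚ.toℚᵘ (fromℕ a)                                    ∎)
  where open ℚᵘ.≃-Reasoning 

open ≡-Reasoning

private
  variable
    f g f′ g′ : PowerSeries

fromℕ-* : ∀ m n → fromℕ (m *ℕ n) ≡ fromℕ m * fromℕ n
fromℕ-* zero    n = sym (ℚ.*-zeroˡ (fromℕ n))
fromℕ-* (suc m) n = begin
  fromℕ (n + m *ℕ n)                 ≡⟨ fromℕ-+ n (m *ℕ n) ⟩
  fromℕ n ℚ.+ fromℕ (m *ℕ n)         ≡⟨ cong (fromℕ n ℚ.+_) (fromℕ-* m n) ⟩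
  fromℕ n ℚ.+ fromℕ m * fromℕ n      ≡⟨ solveℚ 2 (λ a b → b :+ a :* b := (con 1ℚ :+ a) :* b) refl (fromℕ m) (fromℕ n) ⟩
  (1ℚ ℚ.+ fromℕ m) * fromℕ n         ≡⟨ cong (_* fromℕ n) (fromℕ-+ 1 m) ⟨
  fromℕ (suc m) * fromℕ n            ∎

-- Identities with denominators are proved below in multiplied-out form; this is how the factorials
-- and other factors are removed at the end.
fromℕ-*-cancelˡ : ∀ n .{{_ : NonZero n}} {x y} → fromℕ n * x ≡ fromℕ n * y → x ≡ y
fromℕ-*-cancelˡ n {x} {y} eq = begin
  x                            ≡⟨ unit x ⟨
  + 1 / n * (fromℕ n * x)      ≡⟨ cong (+ 1 / n *_) eq ⟩
  + 1 / n * (fromℕ n * y)      ≡⟨ unit y ⟩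
  y                            ∎
  where
  unit : ∀ z → + 1 / n * (fromℕ n * z) ≡ z
  unit z = begin
    + 1 / n * (fromℕ n * z)    ≡⟨ ℚ.*-assoc (+ 1 / n) (fromℕ n) z ⟨
    + 1 / n * fromℕ n * z      ≡⟨ cong (_* z) (/-*-fromℕ 1 n) ⟩
    1ℚ * z                     ≡⟨ ℚ.*-identityˡ z ⟩
    z                          ∎

-- The commutative semiring of power series

infixl 6 _⊕_
infixr 7 _·_

𝟘 : PowerSeries
𝟘 _ = 0ℚ

_⊕_ : PowerSeries → PowerSeries → PowerSeries
(f ⊕ g) n = f n ℚ.+ g n

_·_ : ℚ → PowerSeries → PowerSeries
(x · f) n = x * f n

⊛-cong : f ≗ f′ → g ≗ g′ → f ⊛ g ≗ f′ ⊛ g′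
⊛-cong p q n = sum-cong-≗ {suc n} λ i → cong₂ _*_ (p (toℕ i)) (q (n ∸ toℕ i))

⊛-congˡ : ∀ f → g ≗ g′ → f ⊛ g ≗ f ⊛ g′
⊛-congˡ f = ⊛-cong {f} λ _ → refl

⊛-congʳ : ∀ g → f ≗ f′ → f ⊛ g ≗ f′ ⊛ g
⊛-congʳ g p = ⊛-cong {g = g} p λ _ → refl

-- By computation `(f ⊛ g) (suc n)` is `f 0 * g (suc n) ℚ.+ (f /𝕥 ⊛ g) n`. The laws of convolution
-- thus follow by induction on the index with the first series varying: the hypothesis is used at
-- `f /𝕥`.
⊛-distribʳ : ∀ h f g → (f ⊕ g) ⊛ h ≗ f ⊛ h ⊕ g ⊛ h
⊛-distribʳ h f g zero =
  solveℚ 3 (λ a b c → (a :+ b) :* c :+ con 0ℚ := (a :* c :+ con 0ℚ) :+ (b :* c :+ con 0ℚ)) refl (f 0) (g 0) (h 0)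
⊛-distribʳ h f g (suc n) = begin
  (f 0 ℚ.+ g 0) * h (suc n) ℚ.+ ((f /𝕥 ⊕ g /𝕥) ⊛ h) n
    ≡⟨ cong ((f 0 ℚ.+ g 0) * h (suc n) ℚ.+_) (⊛-distribʳ h (f /𝕥) (g /𝕥) n) ⟩
  (f 0 ℚ.+ g 0) * h (suc n) ℚ.+ ((f /𝕥 ⊛ h) n ℚ.+ (g /𝕥 ⊛ h) n)
    ≡⟨ solveℚ 5 (λ a b c u v → (a :+ b) :* c :+ (u :+ v) := (a :* c :+ u) :+ (b :* c :+ v)) refl
         (f 0) (g 0) (h (suc n)) ((f /𝕥 ⊛ h) n) ((g /𝕥 ⊛ h) n) ⟩
  (f ⊛ h ⊕ g ⊛ h) (suc n) ∎

·-⊛-assoc : ∀ x f g → (x · f) ⊛ g ≗ x · (f ⊛ g)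
·-⊛-assoc x f g zero =
  solveℚ 3 (λ x a b → x :* a :* b :+ con 0ℚ := x :* (a :* b :+ con 0ℚ)) refl x (f 0) (g 0)
·-⊛-assoc x f g (suc n) = begin
  x * f 0 * g (suc n) ℚ.+ ((x · f /𝕥) ⊛ g) n
    ≡⟨ cong (x * f 0 * g (suc n) ℚ.+_) (·-⊛-assoc x (f /𝕥) g n) ⟩
  x * f 0 * g (suc n) ℚ.+ x * (f /𝕥 ⊛ g) n
    ≡⟨ solveℚ 4 (λ x a b u → x :* a :* b :+ x :* u := x :* (a :* b :+ u)) refl
         x (f 0) (g (suc n)) ((f /𝕥 ⊛ g) n) ⟩
  x * (f ⊛ g) (suc n) ∎

-- The mirror image of the computational unfolding of `_⊛_`, splitting off the last summand instead
-- of the first; commutativity rests on it.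
⊛-sucʳ : ∀ f g n → (f ⊛ g) (suc n) ≡ f (suc n) * g 0 ℚ.+ (f ⊛ g /𝕥) n
⊛-sucʳ f g zero =
  solveℚ 4 (λ a b c d → a :* b :+ (c :* d :+ con 0ℚ) := c :* d :+ (a :* b :+ con 0ℚ)) refl
    (f 0) (g 1) (f 1) (g 0)
⊛-sucʳ f g (suc n) = begin
  f 0 * g (2 + n) ℚ.+ (f /𝕥 ⊛ g) (suc n)
    ≡⟨ cong (f 0 * g (2 + n) ℚ.+_) (⊛-sucʳ (f /𝕥) g n) ⟩
  f 0 * g (2 + n) ℚ.+ (f (2 + n) * g 0 ℚ.+ (f /𝕥 ⊛ g /𝕥) n)
    ≡⟨ solveℚ 3 (λ a b c → a :+ (b :+ c) := b :+ (a :+ c)) refl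
         (f 0 * g (2 + n)) (f (2 + n) * g 0) ((f /𝕥 ⊛ g /𝕥) n) ⟩
  f (2 + n) * g 0 ℚ.+ (f ⊛ g /𝕥) (suc n) ∎

⊛-comm : ∀ f g → f ⊛ g ≗ g ⊛ f
⊛-comm f g zero    = cong (ℚ._+ 0ℚ) (ℚ.*-comm (f 0) (g 0))
⊛-comm f g (suc n) = begin
  f 0 * g (suc n) ℚ.+ (f /𝕥 ⊛ g) n  ≡⟨ cong₂ ℚ._+_ (ℚ.*-comm (f 0) (g (suc n))) (⊛-comm (f /𝕥) g n) ⟩
  g (suc n) * f 0 ℚ.+ (g ⊛ f /𝕥) n  ≡⟨ ⊛-sucʳ g f n ⟨
  (g ⊛ f) (suc n)                    ∎

⊛-assoc : ∀ f g h → (f ⊛ g) ⊛ h ≗ f ⊛ (g ⊛ h)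
⊛-assoc f g h zero =
  solveℚ 3 (λ a b c → (a :* b :+ con 0ℚ) :* c :+ con 0ℚ := a :* (b :* c :+ con 0ℚ) :+ con 0ℚ) refl
    (f 0) (g 0) (h 0)
⊛-assoc f g h (suc n) = begin
  -- The shifted product `(f ⊛ g) /𝕥` unfolds to `f 0 · g /𝕥 ⊕ f /𝕥 ⊛ g`.
  (f 0 * g 0 ℚ.+ 0ℚ) * h (suc n) ℚ.+ ((f 0 · g /𝕥 ⊕ f /𝕥 ⊛ g) ⊛ h) n
    ≡⟨ cong ((f 0 * g 0 ℚ.+ 0ℚ) * h (suc n) ℚ.+_) (⊛-distribʳ h (f 0 · g /𝕥) (f /𝕥 ⊛ g) n) ⟩
  (f 0 * g 0 ℚ.+ 0ℚ) * h (suc n) ℚ.+ (((f 0 · g /𝕥) ⊛ h) n ℚ.+ ((f /𝕥 ⊛ g) ⊛ h) n)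
    ≡⟨ cong₂ (λ u v → (f 0 * g 0 ℚ.+ 0ℚ) * h (suc n) ℚ.+ (u ℚ.+ v))
         (·-⊛-assoc (f 0) (g /𝕥) h n) (⊛-assoc (f /𝕥) g h n) ⟩
  (f 0 * g 0 ℚ.+ 0ℚ) * h (suc n) ℚ.+ (f 0 * (g /𝕥 ⊛ h) n ℚ.+ (f /𝕥 ⊛ (g ⊛ h)) n)
    ≡⟨ solveℚ 5 (λ a b c u v → (a :* b :+ con 0ℚ) :* c :+ (a :* u :+ v) := a :* (b :* c :+ u) :+ v) refl
         (f 0) (g 0) (h (suc n)) ((g /𝕥 ⊛ h) n) ((f /𝕥 ⊛ (g ⊛ h)) n) ⟩
  (f ⊛ (g ⊛ h)) (suc n) ∎

⊛-zeroˡ : ∀ f → 𝟘 ⊛ f ≗ 𝟘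
⊛-zeroˡ f zero    = trans (ℚ.+-identityʳ _) (ℚ.*-zeroˡ (f 0))
⊛-zeroˡ f (suc n) = trans (cong₂ ℚ._+_ (ℚ.*-zeroˡ (f (suc n))) (⊛-zeroˡ f n)) (ℚ.+-identityˡ 0ℚ)

⊛-identityˡ : ∀ f → 𝟙 ⊛ f ≗ f
⊛-identityˡ f zero    = trans (ℚ.+-identityʳ _) (ℚ.*-identityˡ (f 0))
⊛-identityˡ f (suc n) =
  trans (cong₂ ℚ._+_ (ℚ.*-identityˡ (f (suc n))) (⊛-zeroˡ f n)) (ℚ.+-identityʳ (f (suc n)))

⊛-identityʳ : ∀ f → f ⊛ 𝟙 ≗ f
⊛-identityʳ f n = trans (⊛-comm f 𝟙 n) (⊛-identityˡ f n)

-- Feeds the semiring solver, so that products of series can be rearranged up to `_≗_`.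
⊛-⊕-commutativeSemiring : CommutativeSemiring 0ℓ 0ℓ
⊛-⊕-commutativeSemiring = record
  { _+_ = _⊕_
  ; _*_ = _⊛_
  ; 0#  = 𝟘
  ; 1#  = 𝟙
  ; isCommutativeSemiring = IsCommutativeSemiringˡ.isCommutativeSemiring record
    { +-isCommutativeMonoid = ⊕-isCommutativeMonoid
    ; *-isCommutativeMonoid = record
      { isMonoid = record
        { isSemigroup = record
          { isMagma = record
            { isEquivalence = IsCommutativeMonoid.isEquivalence ⊕-isCommutativeMonoid
            ; ∙-cong        = ⊛-cong
            }
          ; assoc = ⊛-assoc
          }
        ; identity = ⊛-identityˡ , ⊛-identityʳ
        }
      ; comm = ⊛-comm
      }
    ; distribʳ = ⊛-distribʳ
    ; zeroˡ    = ⊛-zeroˡ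
    }
  }
  where
  ⊕-isCommutativeMonoid : IsCommutativeMonoid _≗_ _⊕_ 𝟘
  ⊕-isCommutativeMonoid = Pointwise.isCommutativeMonoid ℕ ℚ.+-0-isCommutativeMonoid

open SemiringSolver ⊛-⊕-commutativeSemiring
  using () renaming (solve to solveₛ; _:+_ to _:⊕_; _:*_ to _:⊛_; _:=_ to _:≗_)

-- Multiplication by t and powers of series

t⊛-zero : ∀ f → (𝕥 ⊛ f) 0 ≡ 0ℚ
t⊛-zero f = trans (ℚ.+-identityʳ _) (ℚ.*-zeroˡ (f 0))

t⊛-suc : ∀ f n → (𝕥 ⊛ f) (suc n) ≡ f n
t⊛-suc f n = begin
  0ℚ * f (suc n) ℚ.+ (𝟙 ⊛ f) n   ≡⟨ cong₂ ℚ._+_ (ℚ.*-zeroˡ (f (suc n))) (⊛-identityˡ f n) ⟩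
  0ℚ ℚ.+ f n                     ≡⟨ ℚ.+-identityˡ (f n) ⟩
  f n                            ∎

t^⊛-shift : ∀ m f n → (𝕥 ^ m ⊛ f) (m + n) ≡ f n
t^⊛-shift zero    f n = ⊛-identityˡ f n
t^⊛-shift (suc m) f n = begin
  ((𝕥 ⊛ 𝕥 ^ m) ⊛ f) (suc (m + n))  ≡⟨ ⊛-assoc 𝕥 (𝕥 ^ m) f (suc (m + n)) ⟩
  (𝕥 ⊛ (𝕥 ^ m ⊛ f)) (suc (m + n))  ≡⟨ t⊛-suc (𝕥 ^ m ⊛ f) (m + n) ⟩
  (𝕥 ^ m ⊛ f) (m + n)              ≡⟨ t^⊛-shift m f n ⟩
  f n                              ∎

^-+ : ∀ f m n → f ^ (m + n) ≗ f ^ m ⊛ f ^ n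
^-+ f zero    n i = sym (⊛-identityˡ (f ^ n) i)
^-+ f (suc m) n i = trans (⊛-congˡ f (^-+ f m n) i) (sym (⊛-assoc f (f ^ m) (f ^ n) i))

^-cong : ∀ n → f ≗ g → f ^ n ≗ g ^ n
^-cong zero    p i = refl
^-cong (suc n) p i = ⊛-cong p (^-cong n p) i

^-distrib-⊛ : ∀ f g n → (f ⊛ g) ^ n ≗ f ^ n ⊛ g ^ n
^-distrib-⊛ f g zero    i = sym (⊛-identityˡ 𝟙 i)
^-distrib-⊛ f g (suc n) i = trans (⊛-congˡ (f ⊛ g) (^-distrib-⊛ f g n) i)
  (solveₛ 4 (λ a b c d → (a :⊛ b) :⊛ (c :⊛ d) :≗ (a :⊛ c) :⊛ (b :⊛ d)) (λ _ → refl) f g (f ^ n) (g ^ n) i)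

-- The Euler operator t d/dt: unlike d/dt it does not shift coefficients.
θ : PowerSeries → PowerSeries
θ f n = fromℕ n * f n

-- The Leibniz rule. In the induction the factor `suc n` splits as 1 + n, and the extra 1 accounts
-- for the summand `f /𝕥` in `θ f /𝕥 ≗ f /𝕥 ⊕ θ (f /𝕥)`.
θ-⊛ : ∀ f g → θ (f ⊛ g) ≗ θ f ⊛ g ⊕ f ⊛ θ g
θ-⊛ f g zero =
  solveℚ 2 (λ a b → con 0ℚ :* (a :* b :+ con 0ℚ)
      := (con 0ℚ :* a :* b :+ con 0ℚ) :+ (a :* (con 0ℚ :* b) :+ con 0ℚ)) refl (f 0) (g 0)
θ-⊛ f g (suc n) = begin
  fromℕ (suc n) * (f 0 * g (suc n) ℚ.+ (f /𝕥 ⊛ g) n)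
    ≡⟨ solveℚ 4 (λ N a b u → N :* (a :* b :+ u) := a :* (N :* b) :+ N :* u) refl
         (fromℕ (suc n)) (f 0) (g (suc n)) ((f /𝕥 ⊛ g) n) ⟩
  f 0 * θ g (suc n) ℚ.+ fromℕ (suc n) * (f /𝕥 ⊛ g) n
    ≡⟨ cong (λ N → f 0 * θ g (suc n) ℚ.+ N * (f /𝕥 ⊛ g) n) (fromℕ-+ 1 n) ⟩
  f 0 * θ g (suc n) ℚ.+ (1ℚ ℚ.+ fromℕ n) * (f /𝕥 ⊛ g) n
    ≡⟨ solveℚ 3 (λ N a u → a :+ (con 1ℚ :+ N) :* u := a :+ (u :+ N :* u)) refl
         (fromℕ n) (f 0 * θ g (suc n)) ((f /𝕥 ⊛ g) n) ⟩
  f 0 * θ g (suc n) ℚ.+ ((f /𝕥 ⊛ g) n ℚ.+ θ (f /𝕥 ⊛ g) n)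
    ≡⟨ cong (λ u → f 0 * θ g (suc n) ℚ.+ ((f /𝕥 ⊛ g) n ℚ.+ u)) (θ-⊛ (f /𝕥) g n) ⟩
  f 0 * θ g (suc n) ℚ.+ ((f /𝕥 ⊛ g) n ℚ.+ ((θ (f /𝕥) ⊛ g) n ℚ.+ (f /𝕥 ⊛ θ g) n))
    -- The product `0ℚ * f 0 * g (suc n)` is inserted as the leading term of the convolution with
    -- `θ f`, whose constant coefficient is `0ℚ * f 0`.
    ≡⟨ solveℚ 6 (λ a b a0 u v w → a :+ (u :+ (v :+ w)) := (con 0ℚ :* a0 :* b :+ (u :+ v)) :+ (a :+ w)) refl
         (f 0 * θ g (suc n)) (g (suc n)) (f 0) ((f /𝕥 ⊛ g) n) ((θ (f /𝕥) ⊛ g) n) ((f /𝕥 ⊛ θ g) n) ⟩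
  (0ℚ * f 0 * g (suc n) ℚ.+ ((f /𝕥 ⊛ g) n ℚ.+ (θ (f /𝕥) ⊛ g) n)) ℚ.+ (f ⊛ θ g) (suc n)
    ≡⟨ cong (λ u → (0ℚ * f 0 * g (suc n) ℚ.+ u) ℚ.+ (f ⊛ θ g) (suc n))
         (trans (⊛-congʳ g θ-/𝕥 n) (⊛-distribʳ g (f /𝕥) (θ (f /𝕥)) n)) ⟨
  (θ f ⊛ g ⊕ f ⊛ θ g) (suc n) ∎
  where
  θ-/𝕥 : θ f /𝕥 ≗ f /𝕥 ⊕ θ (f /𝕥)
  θ-/𝕥 k = trans (cong (_* f (suc k)) (fromℕ-+ 1 k))
    (solveℚ 2 (λ N a → (con 1ℚ :+ N) :* a := a :+ N :* a) refl (fromℕ k) (f (suc k)))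

θ-^ : ∀ f n → θ (f ^ suc n) ≗ fromℕ (suc n) · (f ^ n ⊛ θ f)
θ-^ f zero i = begin
  θ (f ⊛ 𝟙) i           ≡⟨ cong (fromℕ i *_) (⊛-identityʳ f i) ⟩
  θ f i                  ≡⟨ ⊛-identityˡ (θ f) i ⟨
  (𝟙 ⊛ θ f) i           ≡⟨ ℚ.*-identityˡ ((𝟙 ⊛ θ f) i) ⟨
  1ℚ * (𝟙 ⊛ θ f) i      ∎
θ-^ f (suc n) i = begin
  θ (f ⊛ f ^ suc n) i
    ≡⟨ θ-⊛ f (f ^ suc n) i ⟩
  (θ f ⊛ f ^ suc n) i ℚ.+ (f ⊛ θ (f ^ suc n)) i
    ≡⟨ cong₂ ℚ._+_ (⊛-comm (θ f) (f ^ suc n) i) (trans (⊛-congˡ f (θ-^ f n) i) (⊛-comm f (N · (f ^ n ⊛ θ f)) i)) ⟩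
  (f ^ suc n ⊛ θ f) i ℚ.+ ((N · (f ^ n ⊛ θ f)) ⊛ f) i
    ≡⟨ cong ((f ^ suc n ⊛ θ f) i ℚ.+_) (·-⊛-assoc N (f ^ n ⊛ θ f) f i) ⟩
  (f ^ suc n ⊛ θ f) i ℚ.+ N * ((f ^ n ⊛ θ f) ⊛ f) i
    ≡⟨ cong (λ u → (f ^ suc n ⊛ θ f) i ℚ.+ N * u)
         (solveₛ 3 (λ x y z → (y :⊛ z) :⊛ x :≗ (x :⊛ y) :⊛ z) (λ _ → refl) f (f ^ n) (θ f) i) ⟩
  (f ^ suc n ⊛ θ f) i ℚ.+ N * (f ^ suc n ⊛ θ f) i
    ≡⟨ solveℚ 2 (λ N a → a :+ N :* a := (con 1ℚ :+ N) :* a) refl N ((f ^ suc n ⊛ θ f) i) ⟩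
  (1ℚ ℚ.+ N) * (f ^ suc n ⊛ θ f) i
    ≡⟨ cong (_* (f ^ suc n ⊛ θ f) i) (fromℕ-+ 1 (suc n)) ⟨
  fromℕ (2 + n) * (f ^ suc n ⊛ θ f) i ∎
  where
  N : ℚ
  N = fromℕ (suc n)

-- The series eᵗ − 1, (eᵗ − 1)/t and t/(eᵗ − 1)

φ p τ : PowerSeries
φ = eᵗ ⊖ 𝟙
p = φ /𝕥
τ = t/[eᵗ-1]

p⊛τ≗𝟙 : p ⊛ τ ≗ 𝟙
p⊛τ≗𝟙 = ⊛-inverseʳ p

φ≗t⊛p : φ ≗ 𝕥 ⊛ p
φ≗t⊛p zero    = sym (t⊛-zero p)
φ≗t⊛p (suc n) = sym (t⊛-suc p n)

eᵗ-suc : ∀ n → fromℕ (suc n) * eᵗ (suc n) ≡ eᵗ n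
eᵗ-suc n = fromℕ-*-cancelˡ (n !) {{n !≢0}} (begin
  fromℕ (n !) * (fromℕ (suc n) * eᵗ (suc n))
    ≡⟨ solveℚ 3 (λ a b c → a :* (b :* c) := c :* (b :* a)) refl (fromℕ (n !)) (fromℕ (suc n)) (eᵗ (suc n)) ⟩
  eᵗ (suc n) * (fromℕ (suc n) * fromℕ (n !))
    ≡⟨ cong (eᵗ (suc n) *_) (fromℕ-* (suc n) (n !)) ⟨
  eᵗ (suc n) * fromℕ (suc n !)
    ≡⟨ /-*-fromℕ 1 (suc n !) {{suc n !≢0}} ⟩
  1ℚ
    ≡⟨ /-*-fromℕ 1 (n !) {{n !≢0}} ⟨
  eᵗ n * fromℕ (n !)
    ≡⟨ ℚ.*-comm (eᵗ n) (fromℕ (n !)) ⟩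
  fromℕ (n !) * eᵗ n ∎)

p-coeff : ∀ n → p n ≡ eᵗ (suc n)
p-coeff n = ℚ.+-identityʳ (eᵗ (suc n))

θφ≗t⊛eᵗ : θ φ ≗ 𝕥 ⊛ eᵗ
θφ≗t⊛eᵗ zero    = sym (t⊛-zero eᵗ)
θφ≗t⊛eᵗ (suc n) = begin
  fromℕ (suc n) * p n          ≡⟨ cong (fromℕ (suc n) *_) (p-coeff n) ⟩
  fromℕ (suc n) * eᵗ (suc n)   ≡⟨ eᵗ-suc n ⟩
  eᵗ n                         ≡⟨ t⊛-suc eᵗ n ⟨
  (𝕥 ⊛ eᵗ) (suc n)             ∎

-- The product rule for φ = t p, combined with φ′ = eᵗ.
eᵗ≗p⊕θp : eᵗ ≗ p ⊕ θ p
eᵗ≗p⊕θp n = begin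
  eᵗ n                                      ≡⟨ eᵗ-suc n ⟨
  fromℕ (suc n) * eᵗ (suc n)                ≡⟨ cong₂ _*_ (fromℕ-+ 1 n) (sym (p-coeff n)) ⟩
  (1ℚ ℚ.+ fromℕ n) * p n                    ≡⟨ solveℚ 2 (λ N a → (con 1ℚ :+ N) :* a := a :+ N :* a) refl (fromℕ n) (p n) ⟩
  p n ℚ.+ fromℕ n * p n                     ∎

eᵗ≗𝟙⊕φ : eᵗ ≗ 𝟙 ⊕ φ
eᵗ≗𝟙⊕φ n = begin
  eᵗ n                            ≡⟨ ℚ.+-identityʳ (eᵗ n) ⟨
  eᵗ n ℚ.+ 0ℚ                     ≡⟨ cong (eᵗ n ℚ.+_) (ℚ.+-inverseˡ (𝟙 n)) ⟨
  eᵗ n ℚ.+ (ℚ.- 𝟙 n ℚ.+ 𝟙 n)      ≡⟨ solveℚ 3 (λ a b c → a :+ (b :+ c) := c :+ (a :+ b)) refl (eᵗ n) (ℚ.- 𝟙 n) (𝟙 n) ⟩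
  (𝟙 ⊕ φ) n                       ∎

-- Derivatives of powers of τ and residues of φ′/φᵏ

θ𝟙≗𝟘 : θ 𝟙 ≗ 𝟘
θ𝟙≗𝟘 zero    = refl
θ𝟙≗𝟘 (suc n) = ℚ.*-zeroʳ (fromℕ (suc n))

-- Obtained by differentiating p τ = 1. As a vanishing sum it avoids subtraction and fits the
-- semiring solver.
θp⊛τ⊕p⊛θτ≗𝟘 : θ p ⊛ τ ⊕ p ⊛ θ τ ≗ 𝟘
θp⊛τ⊕p⊛θτ≗𝟘 n = begin
  (θ p ⊛ τ ⊕ p ⊛ θ τ) n   ≡⟨ θ-⊛ p τ n ⟨
  θ (p ⊛ τ) n             ≡⟨ cong (fromℕ n *_) (p⊛τ≗𝟙 n) ⟩
  θ 𝟙 n                   ≡⟨ θ𝟙≗𝟘 n ⟩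
  0ℚ                      ∎

-- With eᵗ = p + θp and p τ = 1 one gets eᵗ τ² = τ + τ² θp = τ - θτ; this is multiplied by τⁿ, with
-- the negative term moved to the left.
eᵗ⊛τ^[2+n] : ∀ n → eᵗ ⊛ τ ^ (2 + n) ⊕ τ ^ n ⊛ θ τ ≗ τ ^ suc n
eᵗ⊛τ^[2+n] n i = begin
  (eᵗ ⊛ τ ^ (2 + n) ⊕ τ ^ n ⊛ θ τ) i
    -- The second summand is multiplied by `p ⊛ τ`, that is by 1, so that the solver can collect the
    -- derivative of p τ as a factor.
    ≡⟨ cong₂ ℚ._+_ (⊛-congʳ (τ ^ (2 + n)) eᵗ≗p⊕θp i)
         (sym (trans (⊛-congˡ (τ ^ n ⊛ θ τ) p⊛τ≗𝟙 i) (⊛-identityʳ (τ ^ n ⊛ θ τ) i))) ⟩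
  ((p ⊕ θ p) ⊛ (τ ⊛ (τ ⊛ τ ^ n)) ⊕ (τ ^ n ⊛ θ τ) ⊛ (p ⊛ τ)) i
    ≡⟨ solveₛ 5 (λ P T P′ T′ X → (P :⊕ P′) :⊛ (T :⊛ (T :⊛ X)) :⊕ (X :⊛ T′) :⊛ (P :⊛ T)
                   :≗ (T :⊛ X) :⊛ (P :⊛ T) :⊕ (P′ :⊛ T :⊕ P :⊛ T′) :⊛ (T :⊛ X))
         (λ _ → refl) p τ (θ p) (θ τ) (τ ^ n) i ⟩
  (τ ^ suc n ⊛ (p ⊛ τ) ⊕ (θ p ⊛ τ ⊕ p ⊛ θ τ) ⊛ τ ^ suc n) i
    ≡⟨ cong₂ ℚ._+_ (trans (⊛-congˡ (τ ^ suc n) p⊛τ≗𝟙 i) (⊛-identityʳ (τ ^ suc n) i))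
         (trans (⊛-congʳ (τ ^ suc n) θp⊛τ⊕p⊛θτ≗𝟘 i) (⊛-zeroˡ (τ ^ suc n) i)) ⟩
  (τ ^ suc n) i ℚ.+ 0ℚ
    ≡⟨ ℚ.+-identityʳ ((τ ^ suc n) i) ⟩
  (τ ^ suc n) i ∎

-- Since (n+1) τⁿ θτ = θ(τⁿ⁺¹), the θτ term becomes a multiple by k. In effect eᵗ τⁿ⁺² has
-- (n+1-k)/(n+1) times the k-th coefficient of τⁿ⁺¹: this vanishes at k = n+1, and the ratio is
-- n/(n+k) once n+1 is replaced by n+k.
[eᵗ⊛τ^[2+n]]-coeff : ∀ n k →
  fromℕ (suc n) * (eᵗ ⊛ τ ^ (2 + n)) k ℚ.+ fromℕ k * (τ ^ suc n) k ≡ fromℕ (suc n) * (τ ^ suc n) k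
[eᵗ⊛τ^[2+n]]-coeff n k = begin
  N * (eᵗ ⊛ τ ^ (2 + n)) k ℚ.+ fromℕ k * (τ ^ suc n) k      ≡⟨ cong (N * (eᵗ ⊛ τ ^ (2 + n)) k ℚ.+_) (θ-^ τ n k) ⟩
  N * (eᵗ ⊛ τ ^ (2 + n)) k ℚ.+ N * (τ ^ n ⊛ θ τ) k          ≡⟨ ℚ.*-distribˡ-+ N _ _ ⟨
  N * (eᵗ ⊛ τ ^ (2 + n) ⊕ τ ^ n ⊛ θ τ) k                    ≡⟨ cong (N *_) (eᵗ⊛τ^[2+n] n k) ⟩
  N * (τ ^ suc n) k                                         ∎
  where
  N : ℚ
  N = fromℕ (suc n)

-- The residue of φ′/φⁿ⁺¹.
[eᵗ⊛τ^[1+n]]-residue : ∀ n → (eᵗ ⊛ τ ^ suc n) n ≡ 𝟙 n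
[eᵗ⊛τ^[1+n]]-residue zero    = refl
[eᵗ⊛τ^[1+n]]-residue (suc n) = fromℕ-*-cancelˡ (suc n) (+-cancelʳ _ _ _ (begin
  N * c ℚ.+ N * (τ ^ suc n) (suc n)    ≡⟨ [eᵗ⊛τ^[2+n]]-coeff n (suc n) ⟩
  N * (τ ^ suc n) (suc n)              ≡⟨ solveℚ 2 (λ N a → N :* a := N :* con 0ℚ :+ N :* a) refl N ((τ ^ suc n) (suc n)) ⟩
  N * 0ℚ ℚ.+ N * (τ ^ suc n) (suc n)   ∎))
  where
  N c : ℚ
  N = fromℕ (suc n)
  c = (eᵗ ⊛ τ ^ (2 + n)) (suc n)

-- Lagrange inversion and expansion in powers of φ

-- The source of the weight n/(n+k): the coefficient relation is taken at exponent n+k and the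
-- k-multiples cancel. The left side keeps τⁿ apart, as the series F of `lagrange-bürmann`.
lagrange-coeff : ∀ n k .{{_ : NonZero n}} →
  fromℕ (n + k) * (τ ^ n ⊛ (eᵗ ⊛ τ ^ suc k)) k ≡ fromℕ n * (τ ^ (n + k)) k
lagrange-coeff n@(suc n-1) k = begin
  fromℕ (n + k) * (τ ^ n ⊛ (eᵗ ⊛ τ ^ suc k)) k
    ≡⟨ cong (fromℕ (n + k) *_) (collect k) ⟩
  fromℕ (n + k) * (eᵗ ⊛ τ ^ suc (n + k)) k
    ≡⟨ +-cancelʳ _ _ _ (begin
         fromℕ (n + k) * (eᵗ ⊛ τ ^ suc (n + k)) k ℚ.+ fromℕ k * (τ ^ (n + k)) k
           ≡⟨ [eᵗ⊛τ^[2+n]]-coeff (n-1 + k) k ⟩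
         fromℕ (n + k) * (τ ^ (n + k)) k
           ≡⟨ cong (_* (τ ^ (n + k)) k) (fromℕ-+ n k) ⟩
         (fromℕ n ℚ.+ fromℕ k) * (τ ^ (n + k)) k
           ≡⟨ ℚ.*-distribʳ-+ _ (fromℕ n) (fromℕ k) ⟩
         fromℕ n * (τ ^ (n + k)) k ℚ.+ fromℕ k * (τ ^ (n + k)) k ∎) ⟩
  fromℕ n * (τ ^ (n + k)) k ∎
  where
  collect : τ ^ n ⊛ (eᵗ ⊛ τ ^ suc k) ≗ eᵗ ⊛ τ ^ suc (n + k)
  collect i = begin
    (τ ^ n ⊛ (eᵗ ⊛ (τ ⊛ τ ^ k))) i   ≡⟨ solveₛ 4 (λ A E T B → A :⊛ (E :⊛ (T :⊛ B)) :≗ E :⊛ (T :⊛ (A :⊛ B)))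
                                          (λ _ → refl) (τ ^ n) eᵗ τ (τ ^ k) i ⟩
    (eᵗ ⊛ (τ ⊛ (τ ^ n ⊛ τ ^ k))) i   ≡⟨ ⊛-congˡ eᵗ (⊛-congˡ τ (^-+ τ n k)) i ⟨
    (eᵗ ⊛ τ ^ suc (n + k)) i          ∎

-- Lagrange–Bürmann: F = ∑ₖ (Res F φ′/φᵏ⁺¹) φᵏ, tested against a further factor W.
-- The induction replaces F − F(0) by (F − F(0))/φ and W by W φ/t.
lagrange-bürmann : ∀ n F W →
  ∑[ i ≤ n ] ((F ⊛ (eᵗ ⊛ τ ^ suc (toℕ i))) (toℕ i) * (φ ^ toℕ i ⊛ W) n) ≡ (F ⊛ W) n
lagrange-bürmann zero F W = begin
  (F 0 * 1ℚ ℚ.+ 0ℚ) * (1ℚ * W 0 ℚ.+ 0ℚ) ℚ.+ 0ℚ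
    ≡⟨ solveℚ 2 (λ a b → (a :* con 1ℚ :+ con 0ℚ) :* (con 1ℚ :* b :+ con 0ℚ) :+ con 0ℚ := a :* b :+ con 0ℚ)
         refl (F 0) (W 0) ⟩
  F 0 * W 0 ℚ.+ 0ℚ ∎
lagrange-bürmann (suc n) F W = cong₂ ℚ._+_ first (begin
  ∑[ i < suc n ] ((F ⊛ (eᵗ ⊛ τ ^ (2 + toℕ i))) (suc (toℕ i)) * (φ ^ suc (toℕ i) ⊛ W) (suc n))
    ≡⟨ sum-cong-≗ {suc n} (λ i → cong₂ _*_ (residue (toℕ i)) (power (toℕ i))) ⟩
  ∑[ i < suc n ] (((τ ⊛ F /𝕥) ⊛ (eᵗ ⊛ τ ^ suc (toℕ i))) (toℕ i) * (φ ^ toℕ i ⊛ (p ⊛ W)) n)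
    ≡⟨ lagrange-bürmann n (τ ⊛ F /𝕥) (p ⊛ W) ⟩
  ((τ ⊛ F /𝕥) ⊛ (p ⊛ W)) n
    ≡⟨ solveₛ 4 (λ T G P W → (T :⊛ G) :⊛ (P :⊛ W) :≗ (P :⊛ T) :⊛ (G :⊛ W)) (λ _ → refl) τ (F /𝕥) p W n ⟩
  ((p ⊛ τ) ⊛ (F /𝕥 ⊛ W)) n
    ≡⟨ trans (⊛-congʳ (F /𝕥 ⊛ W) p⊛τ≗𝟙 n) (⊛-identityˡ (F /𝕥 ⊛ W) n) ⟩
  (F /𝕥 ⊛ W) n ∎)
  where
  first : (F 0 * 1ℚ ℚ.+ 0ℚ) * (𝟙 ⊛ W) (suc n) ≡ F 0 * W (suc n)
  first = cong₂ _*_ (trans (ℚ.+-identityʳ _) (ℚ.*-identityʳ (F 0))) (⊛-identityˡ W (suc n))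

  -- The constant `F 0` is multiplied by the residue of φ′/φᵏ⁺², which is 0, so only `F /𝕥`
  -- survives; one τ then moves over to it.
  residue : ∀ k → (F ⊛ (eᵗ ⊛ τ ^ (2 + k))) (suc k) ≡ ((τ ⊛ F /𝕥) ⊛ (eᵗ ⊛ τ ^ suc k)) k
  residue k = begin
    F 0 * (eᵗ ⊛ τ ^ (2 + k)) (suc k) ℚ.+ (F /𝕥 ⊛ (eᵗ ⊛ τ ^ (2 + k))) k
      ≡⟨ cong (λ r → F 0 * r ℚ.+ (F /𝕥 ⊛ (eᵗ ⊛ τ ^ (2 + k))) k) ([eᵗ⊛τ^[1+n]]-residue (suc k)) ⟩
    F 0 * 0ℚ ℚ.+ (F /𝕥 ⊛ (eᵗ ⊛ τ ^ (2 + k))) k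
      ≡⟨ solveℚ 2 (λ a b → a :* con 0ℚ :+ b := b) refl (F 0) ((F /𝕥 ⊛ (eᵗ ⊛ τ ^ (2 + k))) k) ⟩
    (F /𝕥 ⊛ (eᵗ ⊛ (τ ⊛ τ ^ suc k))) k
      ≡⟨ solveₛ 4 (λ G E T X → G :⊛ (E :⊛ (T :⊛ X)) :≗ (T :⊛ G) :⊛ (E :⊛ X)) (λ _ → refl)
           (F /𝕥) eᵗ τ (τ ^ suc k) k ⟩
    ((τ ⊛ F /𝕥) ⊛ (eᵗ ⊛ τ ^ suc k)) k ∎

  power : ∀ k → (φ ^ suc k ⊛ W) (suc n) ≡ (φ ^ k ⊛ (p ⊛ W)) n
  power k = begin
    ((φ ⊛ φ ^ k) ⊛ W) (suc n)
      ≡⟨ ⊛-congʳ W (⊛-congʳ (φ ^ k) φ≗t⊛p) (suc n) ⟩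
    (((𝕥 ⊛ p) ⊛ φ ^ k) ⊛ W) (suc n)
      ≡⟨ solveₛ 4 (λ T P X W → ((T :⊛ P) :⊛ X) :⊛ W :≗ T :⊛ (X :⊛ (P :⊛ W))) (λ _ → refl) 𝕥 p (φ ^ k) W (suc n) ⟩
    (𝕥 ⊛ (φ ^ k ⊛ (p ⊛ W))) (suc n)
      ≡⟨ t⊛-suc (φ ^ k ⊛ (p ⊛ W)) n ⟩
    (φ ^ k ⊛ (p ⊛ W)) n ∎

-- Stirling numbers as coefficients of powers of φ

-- Because φ′ = 1 + φ, the derivative of φᵏ⁺¹ is (k+1)(φᵏ + φᵏ⁺¹); on coefficients this is the
-- recurrence defining `S₂`.
S₂-egf : ∀ n k → fromℕ (k !) * fromℕ (S₂ n k) ≡ fromℕ (n !) * (φ ^ k) n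
S₂-egf zero    zero    = refl
S₂-egf zero    (suc k) = begin
  fromℕ (suc k !) * 0ℚ                    ≡⟨ ℚ.*-zeroʳ (fromℕ (suc k !)) ⟩
  0ℚ                                      ≡⟨ trans (ℚ.+-identityʳ _) (ℚ.*-zeroˡ ((φ ^ k) 0)) ⟨
  (φ ^ suc k) 0                           ≡⟨ ℚ.*-identityˡ ((φ ^ suc k) 0) ⟨
  1ℚ * (φ ^ suc k) 0                      ∎
S₂-egf (suc n) zero    = sym (ℚ.*-zeroʳ (fromℕ (suc n !)))
S₂-egf (suc n) (suc k) = begin
  fromℕ (suc k !) * fromℕ (suc k *ℕ S₂ n (suc k) + S₂ n k)
    ≡⟨ cong₂ _*_ (fromℕ-* (suc k) (k !))
         (trans (fromℕ-+ (suc k *ℕ S₂ n (suc k)) (S₂ n k)) (cong (ℚ._+ fromℕ (S₂ n k)) (fromℕ-* (suc k) (S₂ n (suc k))))) ⟩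
  K * fromℕ (k !) * (K * fromℕ (S₂ n (suc k)) ℚ.+ fromℕ (S₂ n k))
    ≡⟨ solveℚ 4 (λ K a s t → K :* a :* (K :* s :+ t) := K :* (K :* a :* s :+ a :* t)) refl
         K (fromℕ (k !)) (fromℕ (S₂ n (suc k))) (fromℕ (S₂ n k)) ⟩
  K * (K * fromℕ (k !) * fromℕ (S₂ n (suc k)) ℚ.+ fromℕ (k !) * fromℕ (S₂ n k))
    ≡⟨ cong (λ x → K * (x * fromℕ (S₂ n (suc k)) ℚ.+ fromℕ (k !) * fromℕ (S₂ n k))) (fromℕ-* (suc k) (k !)) ⟨
  K * (fromℕ (suc k !) * fromℕ (S₂ n (suc k)) ℚ.+ fromℕ (k !) * fromℕ (S₂ n k))
    ≡⟨ cong₂ (λ x y → K * (x ℚ.+ y)) (S₂-egf n (suc k)) (S₂-egf n k) ⟩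
  K * (fromℕ (n !) * (φ ^ suc k) n ℚ.+ fromℕ (n !) * (φ ^ k) n)
    ≡⟨ solveℚ 4 (λ K a s t → K :* (a :* s :+ a :* t) := a :* (K :* (t :+ s))) refl
         K (fromℕ (n !)) ((φ ^ suc k) n) ((φ ^ k) n) ⟩
  fromℕ (n !) * (K * ((φ ^ k) n ℚ.+ (φ ^ suc k) n))
    ≡⟨ cong (fromℕ (n !) *_) derivative ⟨
  fromℕ (n !) * (fromℕ (suc n) * (φ ^ suc k) (suc n))
    ≡⟨ solveℚ 3 (λ a b c → a :* (b :* c) := b :* a :* c) refl (fromℕ (n !)) (fromℕ (suc n)) ((φ ^ suc k) (suc n)) ⟩
  fromℕ (suc n) * fromℕ (n !) * (φ ^ suc k) (suc n)
    ≡⟨ cong (_* (φ ^ suc k) (suc n)) (fromℕ-* (suc n) (n !)) ⟨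
  fromℕ (suc n !) * (φ ^ suc k) (suc n) ∎
  where
  K : ℚ
  K = fromℕ (suc k)

  derivative : θ (φ ^ suc k) (suc n) ≡ K * ((φ ^ k) n ℚ.+ (φ ^ suc k) n)
  derivative = begin
    θ (φ ^ suc k) (suc n)                  ≡⟨ θ-^ φ k (suc n) ⟩
    K * (φ ^ k ⊛ θ φ) (suc n)              ≡⟨ cong (K *_) (⊛-congˡ (φ ^ k) θφ≗t⊛eᵗ (suc n)) ⟩
    K * (φ ^ k ⊛ (𝕥 ⊛ eᵗ)) (suc n)         ≡⟨ cong (K *_) (⊛-congˡ (φ ^ k) (⊛-congˡ 𝕥 eᵗ≗𝟙⊕φ) (suc n)) ⟩
    K * (φ ^ k ⊛ (𝕥 ⊛ (𝟙 ⊕ φ))) (suc n)    ≡⟨ cong (K *_) (solveₛ 4 (λ X T I Φ → X :⊛ (T :⊛ (I :⊕ Φ)) :≗ T :⊛ (I :⊛ X :⊕ Φ :⊛ X))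
                                                (λ _ → refl) (φ ^ k) 𝕥 𝟙 φ (suc n)) ⟩
    K * (𝕥 ⊛ (𝟙 ⊛ φ ^ k ⊕ φ ⊛ φ ^ k)) (suc n)  ≡⟨ cong (K *_) (t⊛-suc (𝟙 ⊛ φ ^ k ⊕ φ ^ suc k) n) ⟩
    K * ((𝟙 ⊛ φ ^ k) n ℚ.+ (φ ^ suc k) n)  ≡⟨ cong (λ x → K * (x ℚ.+ (φ ^ suc k) n)) (⊛-identityˡ (φ ^ k) n) ⟩
    K * ((φ ^ k) n ℚ.+ (φ ^ suc k) n)      ∎

-- Here φᵏ φ′ is the derivative of φᵏ⁺¹/(k+1), so `S₂ n (suc k)` appears with k! in place of (k+1)!.
-- That is the factorial in the numerator of the binomial coefficient.
S₂-φ′ : ∀ n k → fromℕ (n !) * (φ ^ k ⊛ (𝕥 ⊛ eᵗ)) n ≡ fromℕ n * (fromℕ (k !) * fromℕ (S₂ n (suc k)))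
S₂-φ′ n k = fromℕ-*-cancelˡ (suc k) (begin
  K * (fromℕ (n !) * (φ ^ k ⊛ (𝕥 ⊛ eᵗ)) n)
    ≡⟨ solveℚ 3 (λ a b c → a :* (b :* c) := b :* (a :* c)) refl K (fromℕ (n !)) ((φ ^ k ⊛ (𝕥 ⊛ eᵗ)) n) ⟩
  fromℕ (n !) * (K * (φ ^ k ⊛ (𝕥 ⊛ eᵗ)) n)
    ≡⟨ cong (λ x → fromℕ (n !) * (K * x)) (⊛-congˡ (φ ^ k) θφ≗t⊛eᵗ n) ⟨
  fromℕ (n !) * (K * (φ ^ k ⊛ θ φ) n)
    ≡⟨ cong (fromℕ (n !) *_) (θ-^ φ k n) ⟨
  fromℕ (n !) * (fromℕ n * (φ ^ suc k) n)
    ≡⟨ solveℚ 3 (λ a b c → a :* (b :* c) := b :* (a :* c)) refl (fromℕ (n !)) (fromℕ n) ((φ ^ suc k) n) ⟩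
  fromℕ n * (fromℕ (n !) * (φ ^ suc k) n)
    ≡⟨ cong (fromℕ n *_) (S₂-egf n (suc k)) ⟨
  fromℕ n * (fromℕ (suc k !) * s)
    ≡⟨ cong (λ x → fromℕ n * (x * s)) (fromℕ-* (suc k) (k !)) ⟩
  fromℕ n * (K * fromℕ (k !) * s)
    ≡⟨ solveℚ 4 (λ n K a s → n :* (K :* a :* s) := K :* (n :* (a :* s))) refl (fromℕ n) K (fromℕ (k !)) s ⟩
  K * (fromℕ n * (fromℕ (k !) * s)) ∎)
  where
  K s : ℚ
  K = fromℕ (suc k)
  s = fromℕ (S₂ n (suc k))

-- Binomial coefficients through factorials

[k+m]Ck*[k!*m!] : ∀ k m → ((k + m) C k) *ℕ (k ! *ℕ m !) ≡ (k + m) !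
[k+m]Ck*[k!*m!] k m = subst (λ x → ((k + m) C k) *ℕ (k ! *ℕ x !) ≡ (k + m) !) (ℕ.m+n∸m≡n k m) (begin
  ((k + m) C k) *ℕ d             ≡⟨ cong (_*ℕ d) (nCk≡n!/k![n-k]! k≤k+m) ⟩
  ((k + m) ! ℕ/ d) *ℕ d         ≡⟨ m/n*n≡m (k![n∸k]!∣n! k≤k+m) ⟩
  (k + m) !                      ∎)
  where
  k≤k+m : k ≤ k + m
  k≤k+m = ℕ.m≤m+n k m
  d : ℕ
  d = k ! *ℕ (k + m ∸ k) !
  instance
    _ = k !* (k + m ∸ k) !≢0

fromℕ-C : ∀ k m → fromℕ ((k + m) C k) * (fromℕ (k !) * fromℕ (m !)) ≡ fromℕ ((k + m) !)
fromℕ-C k m = begin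
  fromℕ ((k + m) C k) * (fromℕ (k !) * fromℕ (m !))  ≡⟨ cong (fromℕ ((k + m) C k) *_) (fromℕ-* (k !) (m !)) ⟨
  fromℕ ((k + m) C k) * fromℕ (k ! *ℕ m !)           ≡⟨ fromℕ-* ((k + m) C k) (k ! *ℕ m !) ⟨
  fromℕ (((k + m) C k) *ℕ (k ! *ℕ m !))              ≡⟨ cong fromℕ ([k+m]Ck*[k!*m!] k m) ⟩
  fromℕ ((k + m) !)                                  ∎

-- The summand as a product of two coefficients

-- The summand of the theorem with the Stirling index k + m as a free argument `j`, so that this
-- index can be rewritten in one `cong`.
term : (n j k : ℕ) .{{_ : NonZero n}} → ℚ
term n j k = (+ (n *ℕ ((j ∸ 1) C k)) / (n + k)) {{m+n≢0 n k}} * B (n + k) k * fromℕ (S₂ n j)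

-- Splitting φᵐ = tᵐ pᵐ leaves tᵐ⁺¹ as a pure index shift, and the rest has the shape φᵏ W with W =
-- pᵐ eᵗ.
φ^⊛teᵗ-shift : ∀ N m k →
  (φ ^ (k + m) ⊛ (𝕥 ⊛ eᵗ)) (suc m + N) ≡ (φ ^ k ⊛ (p ^ m ⊛ eᵗ)) N
φ^⊛teᵗ-shift N m k = begin
  (φ ^ (k + m) ⊛ (𝕥 ⊛ eᵗ)) (suc m + N)
    ≡⟨ ⊛-congʳ (𝕥 ⊛ eᵗ) (λ i → trans (^-+ φ k m i) (⊛-congˡ (φ ^ k) φ^m i)) (suc m + N) ⟩
  ((φ ^ k ⊛ (𝕥 ^ m ⊛ p ^ m)) ⊛ (𝕥 ⊛ eᵗ)) (suc m + N)
    ≡⟨ solveₛ 5 (λ A X P T E → (A :⊛ (X :⊛ P)) :⊛ (T :⊛ E) :≗ (T :⊛ X) :⊛ (A :⊛ (P :⊛ E))) (λ _ → refl)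
         (φ ^ k) (𝕥 ^ m) (p ^ m) 𝕥 eᵗ (suc m + N) ⟩
  (𝕥 ^ suc m ⊛ (φ ^ k ⊛ (p ^ m ⊛ eᵗ))) (suc m + N)
    ≡⟨ t^⊛-shift (suc m) (φ ^ k ⊛ (p ^ m ⊛ eᵗ)) N ⟩
  (φ ^ k ⊛ (p ^ m ⊛ eᵗ)) N ∎
  where
  φ^m : φ ^ m ≗ 𝕥 ^ m ⊛ p ^ m
  φ^m i = trans (^-cong m φ≗t⊛p i) (^-distrib-⊛ 𝕥 p m i)

-- Here `m` is one less than in the theorem and `N` is the difference n - m there. The binomial
-- coefficient absorbs the k! of `B` and supplies the (k+m)! of `S₂-φ′`, so the remaining factorials
-- m! and (n-1)! do not depend on k.
term-coeff : ∀ N m k → let n-1 = m + N in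
  fromℕ (m !) * term (suc n-1) (suc (k + m)) k
    ≡ fromℕ (n-1 !) * ((τ ^ suc n-1 ⊛ (eᵗ ⊛ τ ^ suc k)) k * (φ ^ k ⊛ (p ^ m ⊛ eᵗ)) N)
-- The factor n + k clears the denominator; the factor n is there because `S₂-φ′` involves n! rather
-- than (n-1)!.
term-coeff N m k = fromℕ-*-cancelˡ (n + k) (fromℕ-*-cancelˡ n (begin
  fromℕ n * (fromℕ (n + k) * (fromℕ (m !) * (q * (fromℕ (k !) * b) * s)))
    ≡⟨ solveℚ 7 (λ n l m q k b s → n :* (l :* (m :* (q :* (k :* b) :* s))) := n :* (q :* l :* (k :* m) :* (b :* s)))
         refl (fromℕ n) (fromℕ (n + k)) (fromℕ (m !)) q (fromℕ (k !)) b s ⟩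
  fromℕ n * (q * fromℕ (n + k) * (fromℕ (k !) * fromℕ (m !)) * (b * s))
    ≡⟨ cong (λ x → fromℕ n * (x * (fromℕ (k !) * fromℕ (m !)) * (b * s)))
         (trans (/-*-fromℕ (n *ℕ ((k + m) C k)) (n + k)) (fromℕ-* n ((k + m) C k))) ⟩
  fromℕ n * (fromℕ n * c * (fromℕ (k !) * fromℕ (m !)) * (b * s))
    ≡⟨ solveℚ 5 (λ n c f b s → n :* (n :* c :* f :* (b :* s)) := n :* b :* (n :* (c :* f :* s))) refl
         (fromℕ n) c (fromℕ (k !) * fromℕ (m !)) b s ⟩
  fromℕ n * b * (fromℕ n * (c * (fromℕ (k !) * fromℕ (m !)) * s))
    ≡⟨ cong (λ x → fromℕ n * b * (fromℕ n * (x * s))) (fromℕ-C k m) ⟩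
  fromℕ n * b * (fromℕ n * (fromℕ ((k + m) !) * s))
    ≡⟨ cong₂ _*_ (lagrange-coeff n k) (trans (cong (fromℕ (n !) *_) (sym (φ^⊛teᵗ-shift N m k))) (S₂-φ′ n (k + m))) ⟨
  fromℕ (n + k) * a * (fromℕ (n !) * d)
    ≡⟨ cong (λ x → fromℕ (n + k) * a * (x * d)) (fromℕ-* n (n-1 !)) ⟩
  fromℕ (n + k) * a * (fromℕ n * fromℕ (n-1 !) * d)
    ≡⟨ solveℚ 5 (λ l a n f d → l :* a :* (n :* f :* d) := n :* (l :* (f :* (a :* d)))) refl
         (fromℕ (n + k)) a (fromℕ n) (fromℕ (n-1 !)) d ⟩
  fromℕ n * (fromℕ (n + k) * (fromℕ (n-1 !) * (a * d))) ∎))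
  where
  n n-1 : ℕ
  n-1 = m + N
  n = suc n-1
  q b s c a d : ℚ
  q = + (n *ℕ ((k + m) C k)) / (n + k)
  b = (τ ^ (n + k)) k
  s = fromℕ (S₂ n (suc (k + m)))
  c = fromℕ ((k + m) C k)
  a = (τ ^ n ⊛ (eᵗ ⊛ τ ^ suc k)) k
  d = (φ ^ k ⊛ (p ^ m ⊛ eᵗ)) N

-- Evaluation of the sum

τ^⊛p^-collapse : ∀ m N → τ ^ suc (m + N) ⊛ (p ^ m ⊛ eᵗ) ≗ eᵗ ⊛ τ ^ suc N
τ^⊛p^-collapse zero    N i = trans (⊛-congˡ (τ ^ suc N) (⊛-identityˡ eᵗ) i) (⊛-comm (τ ^ suc N) eᵗ i)
τ^⊛p^-collapse (suc m) N i = begin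
  ((τ ⊛ τ ^ suc (m + N)) ⊛ ((p ⊛ p ^ m) ⊛ eᵗ)) i
    ≡⟨ solveₛ 5 (λ T X P Q E → (T :⊛ X) :⊛ ((P :⊛ Q) :⊛ E) :≗ (P :⊛ T) :⊛ (X :⊛ (Q :⊛ E))) (λ _ → refl)
         τ (τ ^ suc (m + N)) p (p ^ m) eᵗ i ⟩
  ((p ⊛ τ) ⊛ (τ ^ suc (m + N) ⊛ (p ^ m ⊛ eᵗ))) i
    ≡⟨ trans (⊛-congʳ X p⊛τ≗𝟙 i) (⊛-identityˡ X i) ⟩
  (τ ^ suc (m + N) ⊛ (p ^ m ⊛ eᵗ)) i
    ≡⟨ τ^⊛p^-collapse m N i ⟩
  (eᵗ ⊛ τ ^ suc N) i ∎
  where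
  X : PowerSeries
  X = τ ^ suc (m + N) ⊛ (p ^ m ⊛ eᵗ)

-- The factorials left on the two sides agree when N = 0, and for other N both are multiplied by 0.
[m+N]!*𝟙 : ∀ m N → fromℕ ((m + N) !) * 𝟙 N ≡ fromℕ (m !) * 𝟙 N
[m+N]!*𝟙 m zero    = cong (λ x → fromℕ (x !) * 1ℚ) (ℕ.+-identityʳ m)
[m+N]!*𝟙 m (suc N) = trans (ℚ.*-zeroʳ (fromℕ ((m + suc N) !))) (sym (ℚ.*-zeroʳ (fromℕ (m !))))

δ-+ : ∀ m N → δ m (m + N) ≡ 𝟙 N
δ-+ zero    zero    = refl
δ-+ zero    (suc N) = refl
δ-+ (suc m) N       = δ-+ m N

∑-term : ∀ m N → ∑[ i ≤ N ] term (suc (m + N)) (toℕ i + suc m) (toℕ i) ≡ 𝟙 N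
∑-term m N = fromℕ-*-cancelˡ (m !) {{m !≢0}} (begin
  fromℕ (m !) * ∑[ i ≤ N ] term (suc (m + N)) (toℕ i + suc m) (toℕ i)
    ≡⟨ *-distribˡ-sum {suc N} (fromℕ (m !)) (λ i → term (suc (m + N)) (toℕ i + suc m) (toℕ i)) ⟩
  ∑[ i ≤ N ] (fromℕ (m !) * term (suc (m + N)) (toℕ i + suc m) (toℕ i))
    ≡⟨ sum-cong-≗ {suc N} (λ i → trans
         (cong (λ j → fromℕ (m !) * term (suc (m + N)) j (toℕ i)) (ℕ.+-suc (toℕ i) m))
         (term-coeff N m (toℕ i))) ⟩
  ∑[ i ≤ N ] (fromℕ ((m + N) !) * summand (toℕ i))
    ≡⟨ *-distribˡ-sum {suc N} (fromℕ ((m + N) !)) (λ i → summand (toℕ i)) ⟨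
  fromℕ ((m + N) !) * ∑[ i ≤ N ] summand (toℕ i)
    -- The expansion is used with F = τⁿ, where n = m + N + 1, and W = pᵐ eᵗ.
    ≡⟨ cong (fromℕ ((m + N) !) *_) (lagrange-bürmann N (τ ^ suc (m + N)) (p ^ m ⊛ eᵗ)) ⟩
  fromℕ ((m + N) !) * (τ ^ suc (m + N) ⊛ (p ^ m ⊛ eᵗ)) N
    ≡⟨ cong (fromℕ ((m + N) !) *_) (trans (τ^⊛p^-collapse m N N) ([eᵗ⊛τ^[1+n]]-residue N)) ⟩
  fromℕ ((m + N) !) * 𝟙 N
    ≡⟨ [m+N]!*𝟙 m N ⟩
  fromℕ (m !) * 𝟙 N ∎)
  where
  summand : ℕ → ℚ
  summand k = (τ ^ suc (m + N) ⊛ (eᵗ ⊛ τ ^ suc k)) k * (φ ^ k ⊛ (p ^ m ⊛ eᵗ)) N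

theorem5 : ∀ (n m : ℕ) .{{_ : NonZero n}} → 1 ≤ m → m ≤ n →
    ∑[ i ≤ n ∸ m ]
    (let k = toℕ i in
    (+ (n *ℕ ((k + m ∸ 1) C k)) / (n + k)) {{m+n≢0 n k}}
    * B (n + k) k
    * (+ S₂ n (k + m) / 1))
    ≡ δ m n
-- `∑-term` is taken at N = `n-1 ∸ m-1`; transport then replaces `m-1 + N` by `n-1` in the summand
-- and in δ, while the summation bound, already N, stays fixed.
theorem5 (suc n-1) (suc m-1) _ (s≤s m-1≤n-1) =
  subst (λ x → ∑[ i ≤ n-1 ∸ m-1 ] term (suc x) (toℕ i + suc m-1) (toℕ i) ≡ δ m-1 x) (ℕ.m+[n∸m]≡n m-1≤n-1)
    (trans (∑-term m-1 (n-1 ∸ m-1)) (sym (δ-+ m-1 (n-1 ∸ m-1))))
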